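{- Let $l_\infty$ be an arbitrary line of $\mathrm{PG}(2,3)$, let $\varphi$ be the Veronese mapping from the points of $\mathrm{PG}(2,3)$ to the points of $\mathrm{PG}(5,3)$, let $\Gamma_\infty := l_\infty^{\varphi}$ be the image of $l_\infty$ (a planar quadrangle), and let $\Delta_\infty$ be its diagonal triangle. Let $\mathcal{K} := (\operatorname{im}\varphi \setminus \Gamma_\infty)\cup \Delta_\infty$ be the set of points of $\mathrm{PG}(5,3)$ obtained from the Veronese surface $\operatorname{im}\varphi$ by replacing $\Gamma_\infty$ with $\Delta_\infty$. Then: (i) $\#(\mathcal{H}\cap\mathcal{K})\in\{0,3,6\}$ for every hyperplane $\mathcal{H}$ of $\mathrm{PG}(5,3)$; (ii) $\#\mathcal{K}=12$.
   Context: Let $F=\mathrm{GF}(3)$, let $\mathbf{V}$ be a $3$-dimensional $F$-vector space and $\mathbf{W}=\mathbf{V}\vee\mathbf{V}$ its symmetric tensor square, which has dimension $6$. $\mathrm{PG}(2,3)$ and $\mathrm{PG}(5,3)$ denote the projective spaces on $\mathbf{V}$ and $\mathbf{W}$; their points are the one-dimensional subspaces. The Veronese mapping is $\varphi: F\mathbf{a}\mapsto F(\mathbf{a}\vee\mathbf{a})$; in suitable coordinates, $F(x_0,x_1,x_2)\mapsto F(x_0^2,x_0x_1,x_0x_2,x_1^2,x_1x_2,x_2^2)$. It is injective, and its image $\operatorname{im}\varphi$ is called the Veronese surface. The image under $\varphi$ of a line of $\mathrm{PG}(2,3)$ (viewed as its set of four points) is a non-degenerate conic in a plane of $\mathrm{PG}(5,3)$,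 i.e. four coplanar points no three of which are collinear (a planar quadrangle). The diagonal triangle of a quadrangle $\{A,B,C,D\}$ in a projective plane of order $3$ is the set of its three diagonal points $AB\cap CD$, $AC\cap BD$, $AD\cap BC$; these are not collinear. -}

module Defs where

open import Data.Fin using (Fin; zero; suc; toℕ)
open import Data.Fin.Patterns using (0F; 1F; 2F)
open import Data.Nat as ℕ using (ℕ; suc)
open import Data.Nat.DivMod using (_mod_)
open import Data.Product using (∃; Σ; _×_; _,_; proj₁)
open import Data.Vec using (Vec; []; _∷_; _++_; foldr′; map; replicate; zipWith)
open import Data.Vec.Properties using (∷-injective)
open import Function.Bundles using (Bijection)
open import Level using (0ℓ)
open import Relation.Binary using (Setoid)
import Relation.Binary.Construct.On as On
open import Relation.Binary.PropositionalEquality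
  using (_≡_; refl; cong; cong₂) renaming (setoid to ≡-setoid)
open import Relation.Nullary using (¬_)
open import Relation.Unary using (Pred; _∈_; _⊆_; _∖_; _∪_; _∩_; U)
open import Relation.Unary.Relation.Binary.Equality using (≐-setoid)

-- F is GF(3).

F : Set
F = Fin 3

infixl 6 _+_ _⊕_
infixl 7 _*_ _·_

_+_ _*_ : F → F → F
a + b = (toℕ a ℕ.+ toℕ b) mod 3
a * b = (toℕ a ℕ.* toℕ b) mod 3

_⊕_ : ∀ {n} → Vec F n → Vec F n → Vec F n
_⊕_ = zipWith _+_

_·_ : ∀ {n} → F → Vec F n → Vec F n
c · v = map (c *_) v

𝟎 : ∀ {n} → Vec F n
𝟎 = replicate _ 0F

combination : ∀ {k n} → Vec F k → Vec (Vec F n) k → Vec F n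
combination cs vs = foldr′ _⊕_ 𝟎 (zipWith _·_ cs vs)

Span : ∀ {k n} → Vec (Vec F n) k → Pred (Vec F n) 0ℓ
Span vs v = ∃ λ cs → combination cs vs ≡ v

Independent : ∀ {k n} → Vec (Vec F n) k → Set
Independent vs = ∀ cs → combination cs vs ≡ 𝟎 → cs ≡ 𝟎

-- A k-dimensional subspace of Fⁿ is presented by a basis; equality of
-- subspaces is _≈_ below, which does not depend on the chosen basis.

record Subspace (k n : ℕ) : Set where
  constructor subspace
  field
    basis       : Vec (Vec F n) k
    independent : Independent basis

open Subspace public

⟦_⟧ : ∀ {k n} → Subspace k n → Pred (Vec F n) 0ℓ
⟦ U ⟧ = Span (basis U)

subspaceSetoid : ℕ → ℕ → Setoid 0ℓ 0ℓ
subspaceSetoid k n = On.setoid (≐-setoid (Vec F n) 0ℓ) (⟦_⟧ {k} {n})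

infix 4 _≈_ _≉_

_≈_ _≉_ : ∀ {k n} → Subspace k n → Subspace k n → Set
_≈_ {k} {n} = Setoid._≈_ (subspaceSetoid k n)
U ≉ U′ = ¬ (U ≈ U′)

-- PG(d,3) has projective dimension d, i.e. vector space dimension d + 1.

Point Line Hyperplane : ℕ → Set
Point      d = Subspace 1 (suc d)
Line       d = Subspace 2 (suc d)
Hyperplane d = Subspace d (suc d)

PointSet : ℕ → Set₁
PointSet d = Pred (Point d) 0ℓ

points : ∀ {k d} → Subspace k (suc d) → PointSet d
points U P = ⟦ P ⟧ ⊆ ⟦ U ⟧

-- The points of the line AB (for A ≉ B): those contained in the sum A + B.

join : ∀ {d} → Point d → Point d → PointSet d
join A B P = ⟦ P ⟧ ⊆ Span (basis A ++ basis B)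

-- Points are counted up to _≈_; the membership proofs play no role.

HasCardinality : ∀ {d} → PointSet d → ℕ → Set
HasCardinality {d} S m =
  Bijection (On.setoid {B = Σ (Point d) S} (subspaceSetoid 1 (suc d)) proj₁)
            (≡-setoid (Fin m))

-- Coordinates of a ∨ a in V ∨ V, where V = F³, with respect to the basis
-- eᵢ ∨ eᵢ and 2 (eᵢ ∨ eⱼ) for i < j (recall that 2 is invertible in F).

veronese : Vec F 3 → Vec F 6
veronese (x ∷ y ∷ z ∷ []) =
  x * x ∷ x * y ∷ x * z ∷ y * y ∷ y * z ∷ z * z ∷ []

square≡0 : ∀ x → x * x ≡ 0F → x ≡ 0F
square≡0 0F _  = refl
square≡0 1F ()
square≡0 2F ()

veronese≡𝟎 : ∀ v → veronese v ≡ 𝟎 → v ≡ 𝟎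
veronese≡𝟎 (x ∷ y ∷ z ∷ []) eq
  with refl ← square≡0 x (cong (λ { (a ∷ _) → a }) eq)
     | refl ← square≡0 y (cong (λ { (_ ∷ _ ∷ _ ∷ b ∷ _) → b }) eq)
     | refl ← square≡0 z (cong (λ { (_ ∷ _ ∷ _ ∷ _ ∷ _ ∷ c ∷ _) → c }) eq)
  = refl

scaled≡0 : ∀ c x → suc c * x + 0F ≡ 0F → x ≡ 0F
scaled≡0 c  0F _ = refl
scaled≡0 0F 1F ()
scaled≡0 0F 2F ()
scaled≡0 1F 1F ()
scaled≡0 1F 2F ()

scaled≡𝟎 : ∀ {n} c (v : Vec F n) → suc c · v ⊕ 𝟎 ≡ 𝟎 → v ≡ 𝟎
scaled≡𝟎 c []      _  = refl
scaled≡𝟎 c (x ∷ v) eq with ∷-injective eq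
... | p , q = cong₂ _∷_ (scaled≡0 c x p) (scaled≡𝟎 c v q)

veronese-independent : ∀ v → Independent (v ∷ []) → Independent (veronese v ∷ [])
veronese-independent v ind (zero  ∷ []) _  = refl
veronese-independent v ind (suc c ∷ []) eq
  with refl ← veronese≡𝟎 v (scaled≡𝟎 c (veronese v) eq)
  with () ← ind (1F ∷ []) refl

φ : Point 2 → Point 5
φ (subspace (v ∷ []) ind) = subspace (veronese v ∷ []) (veronese-independent v ind)

image : PointSet 2 → PointSet 5
image S Q = ∃ λ P → P ∈ S × Q ≈ φ P

-- Diagonal points of a quadrangle Γ. As Γ has exactly four points, pairwise
-- distinct A, B, C, D ∈ Γ exhaust it, and the different labellings of the four
-- points give AB ∩ CD, AC ∩ BD and AD ∩ BC.

diagonalTriangle : ∀ {d} → PointSet d → PointSet d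
diagonalTriangle Γ Q = ∃ λ A → ∃ λ B → ∃ λ C → ∃ λ D →
  (A ∈ Γ × B ∈ Γ × C ∈ Γ × D ∈ Γ) ×
  (A ≉ B × A ≉ C × A ≉ D × B ≉ C × B ≉ D × C ≉ D) ×
  Q ∈ join A B ∩ join C D

module _ (l∞ : Line 2) where

  Γ∞ Δ∞ 𝒦 : PointSet 5
  Γ∞ = image (points l∞)
  Δ∞ = diagonalTriangle Γ∞
  𝒦  = (image U ∖ Γ∞) ∪ Δ∞

{-# OPTIONS --safe #-}

-- A line of PG(2,3) and a hyperplane of PG(5,3) are the kernels of nonzero linear
-- forms ℓ and h, which matter only up to a scalar factor. The four vectors a ∨ a with
-- Fa on l∞ do not depend on the sign of a and add up to zero, any three of them being
-- independent; hence the diagonal points are spanned by the sums of two of them. So 𝒦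
-- consists of the points spanned by 9 + 3 vectors that are determined by ℓ, and it
-- remains to count zeros of h among these vectors, for 13 forms ℓ and 364 forms h.

module Submission where

open import Defs
open import Data.Fin using (Fin; zero; suc; funToFin; finToFun; combine)
open import Data.Fin.Patterns using (0F; 1F; 2F)
open import Data.Fin.Properties as Fin
  using (_≟_; all?; pigeonhole; finToFun-funToFin; funToFin-finToFin)
open import Data.List as List
  using (List; []; _∷_; _++_; allFin; cartesianProductWith; filter; length)
open import Data.List.Membership.Propositional using (lose; find) renaming (_∈_ to _∈ₗ_)
open import Data.List.Membership.Propositional.Properties
open import Data.List.Relation.Unary.All as All
  using (All; []; _∷_) renaming (lookup to lookupᴬ)
open import Data.List.Relation.Unary.AllPairs as AllPairs using (AllPairs; []; _∷_; allPairs?)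
import Data.List.Relation.Unary.AllPairs.Properties as AllPairs
open import Data.List.Relation.Unary.Any as Any using (Any; here; any?; index; satisfied)
open import Data.List.Relation.Unary.Any.Properties using (lookup-index; ++⁺ˡ; ++⁺ʳ)
open import Data.Nat as ℕ using (ℕ; zero; suc)
import Data.Nat.Properties as ℕ
open import Data.Product using (∃; Σ; _×_; _,_; proj₁; proj₂)
open import Data.Sum as Sum using (_⊎_; inj₁; inj₂)
open import Data.Vec as Vec using (Vec; []; _∷_; lookup; tabulate; map; replicate)
open import Data.Vec.Properties
open import Data.Vec.Relation.Unary.All using ([]; _∷_) renaming (All to Allⱽ)
open import Function using (_∘_; _⇔_; mk⇔; Equivalence)
open import Level using (0ℓ)
open import Relation.Binary using (Setoid)
open import Relation.Binary.PropositionalEquality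
open import Relation.Nullary
open import Relation.Nullary.Decidable
  using (map′; toWitness; ¬?; _→-dec_; _⊎-dec_; _×-dec_; decidable-stable)
open import Relation.Unary using (Decidable; Pred; _∈_; _⊆_; _∩_; _∖_; U)

open ≡-Reasoning

private variable
  d k m n : ℕ

-- Exhaustive search over coordinate vectors.

infix 4 _≟ⱽ_
_≟ⱽ_ : (u v : Vec F n) → Dec (u ≡ v)
_≟ⱽ_ = ≡-dec _≟_

vectors : ∀ n → List (Vec F n)
vectors zero    = [] ∷ []
vectors (suc n) = cartesianProductWith _∷_ (allFin 3) (vectors n)

∈-vectors : (v : Vec F n) → v ∈ₗ vectors n
∈-vectors []      = here refl
∈-vectors (x ∷ v) = ∈-cartesianProductWith⁺ _∷_ (∈-allFin x) (∈-vectors v)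

all-vectors? : {P : Pred (Vec F n) 0ℓ} → Decidable P → Dec (∀ v → P v)
all-vectors? P? = map′ (λ ps v → lookupᴬ ps (∈-vectors v)) (λ f → All.tabulate λ {v} _ → f v)
  (All.all? P? (vectors _))

any-vector? : {P : Pred (Vec F n) 0ℓ} → Decidable P → Dec (∃ P)
any-vector? P? = map′ satisfied (λ (v , p) → lose (∈-vectors v) p) (any? P? (vectors _))

-- Arithmetic in `F` and in coordinate spaces.

+-comm : ∀ x y → x + y ≡ y + x
+-comm = toWitness {a? = all? λ x → all? λ y → x + y ≟ y + x} _

+-assoc : ∀ x y z → x + y + z ≡ x + (y + z)
+-assoc = toWitness {a? = all? λ x → all? λ y → all? λ z → x + y + z ≟ x + (y + z)} _

+-identityˡ : ∀ x → 0F + x ≡ x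
+-identityˡ = toWitness {a? = all? λ x → 0F + x ≟ x} _

+-identityʳ : ∀ x → x + 0F ≡ x
+-identityʳ = toWitness {a? = all? λ x → x + 0F ≟ x} _

*-comm : ∀ x y → x * y ≡ y * x
*-comm = toWitness {a? = all? λ x → all? λ y → x * y ≟ y * x} _

*-assoc : ∀ x y z → x * y * z ≡ x * (y * z)
*-assoc = toWitness {a? = all? λ x → all? λ y → all? λ z → x * y * z ≟ x * (y * z)} _

*-distribˡ-+ : ∀ x y z → x * (y + z) ≡ x * y + x * z
*-distribˡ-+ = toWitness {a? = all? λ x → all? λ y → all? λ z → x * (y + z) ≟ x * y + x * z} _

*-distribʳ-+ : ∀ x y z → (y + z) * x ≡ y * x + z * x
*-distribʳ-+ = toWitness {a? = all? λ x → all? λ y → all? λ z → (y + z) * x ≟ y * x + z * x} _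

*-identityˡ : ∀ x → 1F * x ≡ x
*-identityˡ = toWitness {a? = all? λ x → 1F * x ≟ x} _

*-zeroʳ : ∀ x → x * 0F ≡ 0F
*-zeroʳ = toWitness {a? = all? λ x → x * 0F ≟ 0F} _

-- As `2F` is -1 in `F`, the expression `u ⊕ 2F · v` stands for the difference of `u` and `v` from
-- here on.
+-inverseʳ : ∀ x → x + 2F * x ≡ 0F
+-inverseʳ = toWitness {a? = all? λ x → x + 2F * x ≟ 0F} _

-- The multiplicative group of `F` has order 2, so dividing by a nonzero scalar is the same as
-- multiplying by it.
≢0⇒*-self-inverse : ∀ x → x ≢ 0F → x * x ≡ 1F
≢0⇒*-self-inverse 0F x≢0 = contradiction refl x≢0
≢0⇒*-self-inverse 1F _   = refl
≢0⇒*-self-inverse 2F _   = refl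

+-interchange : ∀ w x y z → (w + x) + (y + z) ≡ (w + y) + (x + z)
+-interchange = toWitness {a? = all? λ w → all? λ x → all? λ y → all? λ z →
  (w + x) + (y + z) ≟ (w + y) + (x + z)} _

*-cancelˡ-≢0 : ∀ x y → x ≢ 0F → x * y ≡ 0F → y ≡ 0F
*-cancelˡ-≢0 = toWitness
  {a? = all? λ x → all? λ y → ¬? (x ≟ 0F) →-dec ((x * y ≟ 0F) →-dec (y ≟ 0F))} _

⊕-comm : (u v : Vec F n) → u ⊕ v ≡ v ⊕ u
⊕-comm = zipWith-comm +-comm

⊕-assoc : (u v w : Vec F n) → u ⊕ v ⊕ w ≡ u ⊕ (v ⊕ w)
⊕-assoc = zipWith-assoc +-assoc

⊕-identityˡ : (v : Vec F n) → 𝟎 ⊕ v ≡ v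
⊕-identityˡ = zipWith-identityˡ +-identityˡ

⊕-identityʳ : (v : Vec F n) → v ⊕ 𝟎 ≡ v
⊕-identityʳ v = trans (⊕-comm v 𝟎) (⊕-identityˡ v)

⊕-inverseʳ : (v : Vec F n) → v ⊕ 2F · v ≡ 𝟎
⊕-inverseʳ = zipWith-inverseʳ +-inverseʳ

⊕-interchange : (t u v w : Vec F n) → t ⊕ u ⊕ (v ⊕ w) ≡ t ⊕ v ⊕ (u ⊕ w)
⊕-interchange t u v w = begin
  t ⊕ u ⊕ (v ⊕ w)   ≡⟨ ⊕-assoc t u (v ⊕ w) ⟩
  t ⊕ (u ⊕ (v ⊕ w)) ≡⟨ cong (t ⊕_) (⊕-assoc u v w) ⟨
  t ⊕ (u ⊕ v ⊕ w)   ≡⟨ cong (λ x → t ⊕ (x ⊕ w)) (⊕-comm u v) ⟩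
  t ⊕ (v ⊕ u ⊕ w)   ≡⟨ cong (t ⊕_) (⊕-assoc v u w) ⟩
  t ⊕ (v ⊕ (u ⊕ w)) ≡⟨ ⊕-assoc t v (u ⊕ w) ⟨
  t ⊕ v ⊕ (u ⊕ w)   ∎

·-identityˡ : (v : Vec F n) → 1F · v ≡ v
·-identityˡ v = trans (map-cong *-identityˡ v) (map-id v)

·-zeroˡ : (v : Vec F n) → 0F · v ≡ 𝟎
·-zeroˡ v = map-const v 0F

·-zeroʳ : ∀ c → c · 𝟎 {n} ≡ 𝟎
·-zeroʳ {n} c = trans (map-replicate (c *_) 0F n) (cong (replicate n) (*-zeroʳ c))

·-assoc : ∀ a b (v : Vec F n) → (a * b) · v ≡ a · (b · v)
·-assoc a b v = trans (map-cong (*-assoc a b) v) (map-∘ (a *_) (b *_) v)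

·-distribˡ-⊕ : ∀ c (u v : Vec F n) → c · (u ⊕ v) ≡ c · u ⊕ c · v
·-distribˡ-⊕ c []      []      = refl
·-distribˡ-⊕ c (x ∷ u) (y ∷ v) = cong₂ _∷_ (*-distribˡ-+ c x y) (·-distribˡ-⊕ c u v)

·-distribʳ-+ : ∀ a b (v : Vec F n) → (a + b) · v ≡ a · v ⊕ b · v
·-distribʳ-+ a b []      = refl
·-distribʳ-+ a b (x ∷ v) = cong₂ _∷_ (*-distribʳ-+ x a b) (·-distribʳ-+ a b v)

·-self-inverse : ∀ c (v : Vec F n) → c ≢ 0F → c · (c · v) ≡ v
·-self-inverse c v c≢0 = begin
  c · (c · v) ≡⟨ ·-assoc c c v ⟨
  (c * c) · v ≡⟨ cong (_· v) (≢0⇒*-self-inverse c c≢0) ⟩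
  1F · v      ≡⟨ ·-identityˡ v ⟩
  v           ∎

⊕-inverse-unique : (u v : Vec F n) → u ⊕ 2F · v ≡ 𝟎 → u ≡ v
⊕-inverse-unique u v eq = begin
  u                  ≡⟨ ⊕-identityʳ u ⟨
  u ⊕ 𝟎              ≡⟨ cong (u ⊕_) (⊕-inverseʳ v) ⟨
  u ⊕ (v ⊕ 2F · v)   ≡⟨ cong (u ⊕_) (⊕-comm v _) ⟩
  u ⊕ (2F · v ⊕ v)   ≡⟨ ⊕-assoc u _ v ⟨
  u ⊕ 2F · v ⊕ v     ≡⟨ cong (_⊕ v) eq ⟩
  𝟎 ⊕ v              ≡⟨ ⊕-identityˡ v ⟩
  v                  ∎

-- Linear combinations and spans.

combination-⊕ : ∀ cs ds (vs : Vec (Vec F n) k) →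
  combination (cs ⊕ ds) vs ≡ combination cs vs ⊕ combination ds vs
combination-⊕ []       []       []       = sym (⊕-identityˡ 𝟎)
combination-⊕ (c ∷ cs) (d ∷ ds) (v ∷ vs) =
  trans (cong₂ _⊕_ (·-distribʳ-+ c d v) (combination-⊕ cs ds vs))
        (⊕-interchange (c · v) (d · v) _ _)

combination-· : ∀ c cs (vs : Vec (Vec F n) k) → combination (c · cs) vs ≡ c · combination cs vs
combination-· c []       []       = sym (·-zeroʳ c)
combination-· c (d ∷ cs) (v ∷ vs) =
  trans (cong₂ _⊕_ (·-assoc c d v) (combination-· c cs vs))
        (sym (·-distribˡ-⊕ c _ _))

span-⊕ : {vs : Vec (Vec F n) k} {u v : Vec F n} → u ∈ Span vs → v ∈ Span vs → u ⊕ v ∈ Span vs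
span-⊕ {vs = vs} (cs , refl) (ds , refl) = cs ⊕ ds , combination-⊕ cs ds vs

span-· : ∀ {vs : Vec (Vec F n) k} c {v} → v ∈ Span vs → c · v ∈ Span vs
span-· {vs = vs} c (cs , refl) = c · cs , combination-· c cs vs

span-𝟎 : {vs : Vec (Vec F n) k} → 𝟎 ∈ Span vs
span-𝟎 {vs = []}     = [] , refl
span-𝟎 {vs = v ∷ vs} with span-𝟎 {vs = vs}
... | cs , eq = 0F ∷ cs , trans (cong₂ _⊕_ (·-zeroˡ v) eq) (⊕-identityˡ 𝟎)

span-here : {v : Vec F n} {vs : Vec (Vec F n) k} → v ∈ Span (v ∷ vs)
span-here {v = v} {vs} with cs , eq ← span-𝟎 {vs = vs} =
  1F ∷ cs , trans (cong₂ _⊕_ (·-identityˡ v) eq) (⊕-identityʳ v)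

span-there : {v w : Vec F n} {vs : Vec (Vec F n) k} → v ∈ Span vs → v ∈ Span (w ∷ vs)
span-there {w = w} (cs , refl) =
  0F ∷ cs , trans (cong (_⊕ _) (·-zeroˡ w)) (⊕-identityˡ _)

span-minimal : {vs : Vec (Vec F n) k} {ws : Vec (Vec F n) m} →
  Allⱽ (_∈ Span ws) vs → Span vs ⊆ Span ws
span-minimal []         ([]     , refl) = span-𝟎
span-minimal (p ∷ ps)   (c ∷ cs , refl) = span-⊕ (span-· c p) (span-minimal ps (cs , refl))

-- The standard bilinear form.

dot : Vec F n → Vec F n → F
dot []       []       = 0F
dot (x ∷ xs) (y ∷ ys) = x * y + dot xs ys

orthogonal? : (h : Vec F n) → Decidable (λ v → dot h v ≡ 0F)
orthogonal? h v = dot h v ≟ 0F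

dot-comm : (u v : Vec F n) → dot u v ≡ dot v u
dot-comm []      []      = refl
dot-comm (x ∷ u) (y ∷ v) = cong₂ _+_ (*-comm x y) (dot-comm u v)

dot-zeroˡ : (v : Vec F n) → dot 𝟎 v ≡ 0F
dot-zeroˡ []      = refl
dot-zeroˡ (x ∷ v) = cong (0F +_) (dot-zeroˡ v)

dot-⊕ʳ : (u v w : Vec F n) → dot u (v ⊕ w) ≡ dot u v + dot u w
dot-⊕ʳ []      []      []      = refl
dot-⊕ʳ (x ∷ u) (y ∷ v) (z ∷ w) = begin
  x * (y + z) + dot u (v ⊕ w)             ≡⟨ cong₂ _+_ (*-distribˡ-+ x y z) (dot-⊕ʳ u v w) ⟩
  (x * y + x * z) + (dot u v + dot u w)   ≡⟨ +-interchange (x * y) (x * z) _ _ ⟩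
  (x * y + dot u v) + (x * z + dot u w)   ∎

dot-⊕ˡ : (u v w : Vec F n) → dot (u ⊕ v) w ≡ dot u w + dot v w
dot-⊕ˡ u v w = trans (dot-comm (u ⊕ v) w)
  (trans (dot-⊕ʳ w u v) (cong₂ _+_ (dot-comm w u) (dot-comm w v)))

dot-·ʳ : ∀ c (u v : Vec F n) → dot u (c · v) ≡ c * dot u v
dot-·ʳ c []      []      = sym (*-zeroʳ c)
dot-·ʳ c (x ∷ u) (y ∷ v) = begin
  x * (c * y) + dot u (c · v)  ≡⟨ cong (_+ _) (*-assoc x c y) ⟨
  x * c * y + dot u (c · v)    ≡⟨ cong₂ (λ a b → a * y + b) (*-comm x c) (dot-·ʳ c u v) ⟩
  c * x * y + c * dot u v      ≡⟨ cong (_+ _) (*-assoc c x y) ⟩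
  c * (x * y) + c * dot u v    ≡⟨ *-distribˡ-+ c _ _ ⟨
  c * (x * y + dot u v)        ∎

dot-·ˡ : ∀ c (u v : Vec F n) → dot (c · u) v ≡ c * dot u v
dot-·ˡ c u v = trans (dot-comm (c · u) v) (trans (dot-·ʳ c v u) (cong (c *_) (dot-comm v u)))

dot-span : ∀ h (vs : Vec (Vec F n) k) → map (dot h) vs ≡ 𝟎 → ∀ {v} → v ∈ Span vs → dot h v ≡ 0F
dot-span h []       _  ([]     , refl) = trans (dot-comm h 𝟎) (dot-zeroˡ h)
dot-span h (v ∷ vs) eq (c ∷ cs , refl) = begin
  dot h (c · v ⊕ combination cs vs)         ≡⟨ dot-⊕ʳ h (c · v) _ ⟩
  dot h (c · v) + dot h (combination cs vs) ≡⟨ cong₂ _+_ (dot-·ʳ c h v) hw≡0 ⟩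
  c * dot h v + 0F                          ≡⟨ cong (λ x → c * x + 0F) hv≡0 ⟩
  c * 0F + 0F                               ≡⟨ cong (_+ 0F) (*-zeroʳ c) ⟩
  0F                                        ∎
  where
  hv≡0 = proj₁ (∷-injective eq)
  hw≡0 = dot-span h vs (proj₂ (∷-injective eq)) (cs , refl)

-- Linear maps and their kernels.

record Linear (f : Vec F m → Vec F n) : Set where
  field
    additive    : ∀ u v → f (u ⊕ v) ≡ f u ⊕ f v
    homogeneous : ∀ c v → f (c · v) ≡ c · f v

open Linear

private
  -- Numbering the vectors makes the pigeonhole principle for `Fin` applicable to maps between
  -- coordinate spaces.
  encode : Vec F n → Fin (3 ℕ.^ n)
  encode = funToFin ∘ lookup

  decode : Fin (3 ℕ.^ n) → Vec F n
  decode = tabulate ∘ finToFun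

  decode-encode : (v : Vec F n) → decode (encode v) ≡ v
  decode-encode v = trans (tabulate-cong (finToFun-funToFin (lookup v))) (tabulate∘lookup v)

  encode-decode : (i : Fin (3 ℕ.^ n)) → encode {n} (decode i) ≡ i
  encode-decode {n} i =
    trans (funToFin-cong (lookup∘tabulate (finToFun {3} {n} i))) (funToFin-finToFin {n} i)
    where
    -- `lookup∘tabulate` gives a pointwise equality only, which has to be carried through `funToFin`
    -- without function extensionality.
    funToFin-cong : ∀ {n} {f g : Fin n → F} → f ≗ g → funToFin f ≡ funToFin g
    funToFin-cong {zero}  f≗g = refl
    funToFin-cong {suc n} f≗g = cong₂ combine (f≗g zero) (funToFin-cong (f≗g ∘ suc))

opaque
  -- As 3ᵐ > 3ⁿ, two vectors have the same image; their difference is in the kernel.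
  kernel-nontrivial : n ℕ.< m → {f : Vec F m → Vec F n} → Linear f → ∃ λ v → v ≢ 𝟎 × f v ≡ 𝟎
  kernel-nontrivial {n} {m} n<m {f} lin
    with i , j , i<j , eq ← pigeonhole (ℕ.^-monoʳ-< 3 (ℕ.s≤s (ℕ.s≤s ℕ.z≤n)) n<m)
                                       (encode ∘ f ∘ decode {m}) =
    u ⊕ 2F · v , u⊖v≢𝟎 , f[u⊖v]≡𝟎
    where
    u v : Vec F m
    u = decode i
    v = decode j

    fu≡fv : f u ≡ f v
    fu≡fv = trans (sym (decode-encode (f u))) (trans (cong decode eq) (decode-encode (f v)))

    u⊖v≢𝟎 : u ⊕ 2F · v ≢ 𝟎
    u⊖v≢𝟎 u⊖v≡𝟎 = Fin.<⇒≢ i<j (trans (sym (encode-decode {m} i))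
      (trans (cong encode (⊕-inverse-unique u v u⊖v≡𝟎)) (encode-decode {m} j)))

    f[u⊖v]≡𝟎 : f (u ⊕ 2F · v) ≡ 𝟎
    f[u⊖v]≡𝟎 = begin
      f (u ⊕ 2F · v)   ≡⟨ additive lin u (2F · v) ⟩
      f u ⊕ f (2F · v) ≡⟨ cong₂ _⊕_ fu≡fv (homogeneous lin 2F v) ⟩
      f v ⊕ 2F · f v   ≡⟨ ⊕-inverseʳ (f v) ⟩
      𝟎                ∎

combination-linear : (vs : Vec (Vec F n) k) → Linear (λ cs → combination cs vs)
combination-linear vs = record
  { additive    = λ cs ds → combination-⊕ cs ds vs
  ; homogeneous = λ c cs → combination-· c cs vs
  }

dots-linear : (vs : Vec (Vec F n) k) → Linear (λ h → map (dot h) vs)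
dots-linear []       = record { additive = λ _ _ → refl ; homogeneous = λ _ _ → refl }
dots-linear (v ∷ vs) = record
  { additive    = λ g h → cong₂ _∷_ (dot-⊕ˡ g h v) (additive (dots-linear vs) g h)
  ; homogeneous = λ c h → cong₂ _∷_ (dot-·ˡ c h v) (homogeneous (dots-linear vs) c h)
  }

-- Hyperplanes as kernels of linear forms.

dot-nondegenerate : (h : Vec F n) → h ≢ 𝟎 → ∃ λ v → dot h v ≢ 0F
dot-nondegenerate []      h≢𝟎 = contradiction refl h≢𝟎
dot-nondegenerate (0F ∷ h) h≢𝟎 with dot-nondegenerate h (h≢𝟎 ∘ cong (0F ∷_))
... | v , hv≢0 = 0F ∷ v , hv≢0 ∘ trans (sym (+-identityˡ _))
-- The first nonzero entry `x` of the form is its own inverse, so putting `x` in the same place of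
-- the test vector gives the value 1.
dot-nondegenerate (x@(suc _) ∷ h) _ = x ∷ 𝟎 , λ eq → contradiction (trans (sym lemma) eq) λ ()
  where
  lemma : dot (x ∷ h) (x ∷ 𝟎) ≡ 1F
  lemma = cong₂ _+_ (≢0⇒*-self-inverse x λ ()) (trans (dot-comm h 𝟎) (dot-zeroˡ h))

-- If dot h p ≠ 0 and dot h v = 0, a linear dependency between p, v and the n
-- basis vectors does not involve p, and it involves v as the basis is independent.
hyperplane-equation : (V : Subspace n (suc n)) →
  ∃ λ h → h ≢ 𝟎 × (∀ v → v ∈ ⟦ V ⟧ ⇔ dot h v ≡ 0F)
hyperplane-equation {n} (subspace vs ind)
  -- Orthogonality to the n basis vectors is a linear map from dimension n + 1 to dimension n, so
  -- some nonzero `h` satisfies it.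
  with h , h≢𝟎 , hvs≡𝟎 ← kernel-nontrivial (ℕ.n<1+n n) (dots-linear vs)
  with p , hp≢0 ← dot-nondegenerate h h≢𝟎 =
  h , h≢𝟎 , λ v → mk⇔ (dot-span h vs hvs≡𝟎) (complete v)
  where
  complete : ∀ v → dot h v ≡ 0F → v ∈ Span vs
  complete v hv≡0
    with kernel-nontrivial (ℕ.n<1+n (suc n)) (combination-linear (p ∷ v ∷ vs))
  -- Once `a` is zero and `b` is not, the dependency reads `b · v ≡ 2F · w`; multiplying by the
  -- self-inverse `b` exhibits `v` as a multiple of `w`.
  ... | a ∷ b ∷ cs , nonzero , eq = subst (_∈ Span vs) (·-self-inverse b v b≢0)
    (span-· b (subst (_∈ Span vs) (sym bv≡2w) (span-· 2F (cs , refl))))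
    where
    w : Vec F (suc n)
    w = combination cs vs

    h[bv+w]≡0 : dot h (b · v ⊕ w) ≡ 0F
    h[bv+w]≡0 = dot-span h (v ∷ vs) (cong₂ _∷_ hv≡0 hvs≡𝟎) (b ∷ cs , refl)

    a≡0 : a ≡ 0F
    -- Under `dot h` every term of the dependency vanishes except the one with `p`.
    a≡0 = decidable-stable (a ≟ 0F) λ a≢0 → hp≢0 (*-cancelˡ-≢0 a _ a≢0 (begin
      a * dot h p                        ≡⟨ dot-·ʳ a h p ⟨
      dot h (a · p)                      ≡⟨ +-identityʳ _ ⟨
      dot h (a · p) + 0F                 ≡⟨ cong (dot h (a · p) +_) h[bv+w]≡0 ⟨
      dot h (a · p) + dot h (b · v ⊕ w)  ≡⟨ dot-⊕ʳ h (a · p) _ ⟨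
      dot h (a · p ⊕ (b · v ⊕ w))        ≡⟨ cong (dot h) eq ⟩
      dot h 𝟎                            ≡⟨ trans (dot-comm h 𝟎) (dot-zeroˡ h) ⟩
      0F                                 ∎))

    bv+w≡𝟎 : b · v ⊕ w ≡ 𝟎
    bv+w≡𝟎 = begin
      b · v ⊕ w            ≡⟨ ⊕-identityˡ _ ⟨
      𝟎 ⊕ (b · v ⊕ w)      ≡⟨ cong (_⊕ (b · v ⊕ w)) (·-zeroˡ p) ⟨
      0F · p ⊕ (b · v ⊕ w) ≡⟨ cong (λ c → c · p ⊕ (b · v ⊕ w)) a≡0 ⟨
      a · p ⊕ (b · v ⊕ w)  ≡⟨ eq ⟩
      𝟎                    ∎

    b≢0 : b ≢ 0F
    b≢0 b≡0 = nonzero (cong₂ _∷_ a≡0 (cong₂ _∷_ b≡0 (ind cs (begin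
      w            ≡⟨ ⊕-identityˡ w ⟨
      𝟎 ⊕ w        ≡⟨ cong (_⊕ w) (·-zeroˡ v) ⟨
      0F · v ⊕ w   ≡⟨ cong (λ c → c · v ⊕ w) b≡0 ⟨
      b · v ⊕ w    ≡⟨ bv+w≡𝟎 ⟩
      𝟎            ∎))))

    bv≡2w : b · v ≡ 2F · w
    -- Here `w` is read as `2F · (2F · w)`, which turns the sum into a difference.
    bv≡2w = ⊕-inverse-unique (b · v) (2F · w)
      (trans (cong (b · v ⊕_) (·-self-inverse 2F w λ ())) bv+w≡𝟎)

-- Proportionality and normalised vectors.

infix 4 _∼_ _≁_ _∼?_ _∈Span?_

-- This is not symmetric, since `𝟎 ∼ w` for every `w`; between nonzero vectors it is equality of
-- projective points.
_∼_ _≁_ : Vec F n → Vec F n → Set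
v ∼ w = v ∈ Span (w ∷ [])
v ≁ w = ¬ v ∼ w

_∈Span?_ : (v : Vec F n) (vs : Vec (Vec F n) k) → Dec (v ∈ Span vs)
v ∈Span? vs = any-vector? λ cs → combination cs vs ≟ⱽ v

_∼?_ : (v w : Vec F n) → Dec (v ∼ w)
v ∼? w = v ∈Span? (w ∷ [])

∼-scaled : ∀ c (v : Vec F n) → c · v ∼ v
∼-scaled c v = c ∷ [] , ⊕-identityʳ (c · v)

∼-refl : {v : Vec F n} → v ∼ v
∼-refl {v = v} = subst (_∼ v) (·-identityˡ v) (∼-scaled 1F v)

∼⇒∈ : {v w : Vec F n} {vs : Vec (Vec F n) k} → v ∼ w → w ∈ Span vs → v ∈ Span vs
∼⇒∈ v∼w w∈vs = span-minimal (w∈vs ∷ []) v∼w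

-- A nonzero multiple of `w` has a nonzero coefficient, and scaling by that coefficient once more
-- leads back to `w`.
∼-sym : {v w : Vec F n} → v ≢ 𝟎 → v ∼ w → w ∼ v
∼-sym {v = v} {w} v≢𝟎 (c ∷ [] , refl) = subst (λ u → w ∼ u) (sym (⊕-identityʳ (c · w)))
  (subst (_∼ c · w) (·-self-inverse c w c≢0) (∼-scaled c (c · w)))
  where
  c≢0 : c ≢ 0F
  c≢0 c≡0 = v≢𝟎 (trans (⊕-identityʳ (c · w)) (trans (cong (_· w) c≡0) (·-zeroˡ w)))

∼-dot : ∀ (h : Vec F n) {v w} → v ∼ w → dot h w ≡ 0F → dot h v ≡ 0F
∼-dot h v∼w hw≡0 = dot-span h _ (cong (_∷ []) hw≡0) v∼w

-- The first nonzero entry is 1, which selects one vector from each one-dimensional subspace: 13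
-- vectors for n = 3 and 364 for n = 6.
normalised : ∀ n → List (Vec F n)
normalised zero    = []
normalised (suc n) = List.map (1F ∷_) (vectors n) ++ List.map (0F ∷_) (normalised n)

normalise : (v : Vec F n) → v ≢ 𝟎 → Any (v ∼_) (normalised n)
normalise []       v≢𝟎 = contradiction refl v≢𝟎
normalise (0F ∷ v) v≢𝟎
  with w , w∈ , c ∷ [] , refl ← find (normalise v (v≢𝟎 ∘ cong (0F ∷_))) =
  lose (∈-++⁺ʳ _ (∈-map⁺ (0F ∷_) w∈))
    (c ∷ [] , cong (_∷ (c · w ⊕ 𝟎)) (trans (+-identityʳ (c * 0F)) (*-zeroʳ c)))
normalise v@(x@(suc _) ∷ u) v≢𝟎 =
  lose (∈-++⁺ˡ (∈-map⁺ (1F ∷_) (∈-vectors (x · u))))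
    (∼-sym xv≢𝟎 (subst (_∼ v) (cong (_∷ x · u) (≢0⇒*-self-inverse x λ ())) (∼-scaled x v)))
  where
  xv≢𝟎 : 1F ∷ x · u ≢ 𝟎
  xv≢𝟎 ()

normalised-≢𝟎 : {v : Vec F n} → v ∈ₗ normalised n → v ≢ 𝟎
normalised-≢𝟎 {suc n} v∈ v≡𝟎 with ∈-++⁻ (List.map (1F ∷_) (vectors n)) v∈
... | inj₁ v∈₁ with _ , _ , refl ← ∈-map⁻ (1F ∷_) v∈₁ = contradiction v≡𝟎 λ ()
... | inj₂ v∈₂ with _ , w∈ , refl ← ∈-map⁻ (0F ∷_) v∈₂ = normalised-≢𝟎 w∈ (cong Vec.tail v≡𝟎)

-- Points, their representing vectors, and cardinality.

vec : Point d → Vec F (suc d)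
vec (subspace (v ∷ []) _) = v

vec≢𝟎 : (P : Point d) → vec P ≢ 𝟎
vec≢𝟎 (subspace (v ∷ []) ind) refl
  with () ← ind (1F ∷ []) (trans (⊕-identityʳ (1F · 𝟎)) (·-zeroʳ 1F))

point : (v : Vec F (suc d)) → v ≢ 𝟎 → Point d
point v v≢𝟎 = subspace (v ∷ []) λ
  { (zero  ∷ []) _  → refl
  ; (suc c ∷ []) eq → contradiction (scaled≡𝟎 c v eq) v≢𝟎
  }

⊆-span : (P : Point d) {vs : Vec (Vec F (suc d)) k} → vec P ∈ Span vs → ⟦ P ⟧ ⊆ Span vs
⊆-span (subspace (v ∷ []) _) v∈vs = span-minimal (v∈vs ∷ [])

∈-span : (P : Point d) {vs : Vec (Vec F (suc d)) k} → ⟦ P ⟧ ⊆ Span vs → vec P ∈ Span vs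
∈-span (subspace (v ∷ []) _) P⊆vs = P⊆vs ∼-refl

∼⇒≈ : (P Q : Point d) → vec P ∼ vec Q → P ≈ Q
∼⇒≈ P@(subspace (_ ∷ []) _) Q@(subspace (_ ∷ []) _) P∼Q =
  ⊆-span P P∼Q , ⊆-span Q (∼-sym (vec≢𝟎 P) P∼Q)

≈⇒∼ : (P Q : Point d) → P ≈ Q → vec P ∼ vec Q
≈⇒∼ P@(subspace (_ ∷ []) _) (subspace (_ ∷ []) _) (P⊆Q , _) = ∈-span P P⊆Q

-- A system of representatives for the points of `S`. Soundness asks for the listed vector itself as
-- basis vector, which excludes `𝟎` from the list.
record Enumerates (S : PointSet d) (vs : List (Vec F (suc d))) : Set where
  field
    sound    : ∀ {v} → v ∈ₗ vs → ∃ λ P → P ∈ S × vec P ≡ v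
    complete : ∀ {P} → P ∈ S → Any (vec P ∼_) vs
    distinct : AllPairs _≁_ vs

-- Two different entries hit by proportional vectors would be proportional to each other. `AllPairs`
-- compares an earlier entry with a later one only, so in both mixed cases the chain runs from the
-- earlier to the later entry.
index-unique : {vs : List (Vec F n)} → AllPairs _≁_ vs → ∀ {v w} → v ≢ 𝟎 → w ≢ 𝟎 → v ∼ w →
  ∀ i j → v ∼ List.lookup vs i → w ∼ List.lookup vs j → i ≡ j
index-unique (_ ∷ _)  _   _   _   zero    zero    _   _   = refl
index-unique (_ ∷ ds) v≢𝟎 w≢𝟎 v∼w (suc i) (suc j) v∼x w∼y =
  cong suc (index-unique ds v≢𝟎 w≢𝟎 v∼w i j v∼x w∼y)
index-unique (d ∷ _)  v≢𝟎 w≢𝟎 v∼w zero    (suc j) v∼x w∼y =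
  contradiction (∼⇒∈ (∼-sym v≢𝟎 v∼x) (∼⇒∈ v∼w w∼y)) (lookupᴬ d (∈-lookup j))
index-unique (d ∷ _)  v≢𝟎 w≢𝟎 v∼w (suc i) zero    v∼x w∼y =
  contradiction (∼⇒∈ (∼-sym w≢𝟎 w∼y) (∼⇒∈ (∼-sym v≢𝟎 v∼w) v∼x)) (lookupᴬ d (∈-lookup i))

-- The index that `complete` yields could a priori vary with the membership proof; `distinct` makes
-- it a function of the point.
cardinality : {S : PointSet d} {vs : List (Vec F (suc d))} →
  Enumerates S vs → HasCardinality S (length vs)
cardinality {S = S} {vs} E = record
  { to        = to
  ; cong      = λ {x} {y} → to-cong {x} {y}
  ; bijective = (λ {x} {y} → to-injective {x} {y}) , to-surjective
  }
  where
  open Enumerates E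

  to : Σ (Point _) S → Fin (length vs)
  to (_ , P∈S) = index (complete P∈S)

  ∼-to : ∀ x → vec (proj₁ x) ∼ List.lookup vs (to x)
  ∼-to (_ , P∈S) = lookup-index (complete P∈S)

  to-unique : ∀ x i {v} → v ≢ 𝟎 → vec (proj₁ x) ∼ v → v ∼ List.lookup vs i → to x ≡ i
  to-unique x i v≢𝟎 x∼v v∼vᵢ =
    index-unique distinct (vec≢𝟎 (proj₁ x)) v≢𝟎 x∼v (to x) i (∼-to x) v∼vᵢ

  to-cong : ∀ {x y} → proj₁ x ≈ proj₁ y → to x ≡ to y
  to-cong {x@(P , _)} {y@(Q , _)} P≈Q = to-unique x (to y) (vec≢𝟎 Q) (≈⇒∼ P Q P≈Q) (∼-to y)

  to-injective : ∀ {x y} → to x ≡ to y → proj₁ x ≈ proj₁ y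
  to-injective {x@(P , _)} {y@(Q , _)} eq = ∼⇒≈ P Q (∼⇒∈ (∼-to x)
    (∼-sym (vec≢𝟎 Q) (subst (λ i → vec Q ∼ List.lookup vs i) (sym eq) (∼-to y))))

  to-surjective : ∀ i → ∃ λ x → ∀ {y} → proj₁ y ≈ proj₁ x → to y ≡ i
  to-surjective i with P , P∈S , P≡vᵢ ← sound (∈-lookup i) =
    (P , P∈S) , λ {y} y≈P →
      to-unique y i (vec≢𝟎 P) (≈⇒∼ (proj₁ y) P y≈P) (subst (vec P ∼_) P≡vᵢ ∼-refl)

-- Hyperplane sections and normalised equations.

section : Vec F n → List (Vec F n) → List (Vec F n)
section h = filter (orthogonal? h)

-- Vanishing of a linear form is invariant under scaling, so filtering the representatives filters
-- the points.
enumerates-section : ∀ {S : PointSet d} {vs} h (H : Hyperplane d) →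
  (∀ v → v ∈ ⟦ H ⟧ ⇔ dot h v ≡ 0F) →
  Enumerates S vs → Enumerates (points H ∩ S) (section h vs)
enumerates-section {S = S} {vs} h H H⇔ E = record
  { sound    = sound′
  ; complete = complete′
  ; distinct = AllPairs.filter⁺ (orthogonal? h) distinct
  }
  where
  open Enumerates E
  open Equivalence

  sound′ : ∀ {v} → v ∈ₗ section h vs → ∃ λ P → P ∈ points H ∩ S × vec P ≡ v
  sound′ v∈ with v∈vs , hv≡0 ← ∈-filter⁻ (orthogonal? h) v∈
            with P , P∈S , refl ← sound v∈vs =
    P , (⊆-span P (from (H⇔ _) hv≡0) , P∈S) , refl

  complete′ : ∀ {P} → P ∈ points H ∩ S → Any (vec P ∼_) (section h vs)
  complete′ {P} (P⊆H , P∈S) with v , v∈vs , P∼v ← find (complete P∈S) =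
    lose (∈-filter⁺ (orthogonal? h) v∈vs
      (∼-dot h (∼-sym (vec≢𝟎 P) P∼v) (to (H⇔ _) (∈-span P P⊆H)))) P∼v

-- Proportional forms have the same zeros, so the equation can be taken from the finite list over
-- which the exhaustive checks range.
normalised-equation : (V : Subspace n (suc n)) →
  ∃ λ h → h ∈ₗ normalised (suc n) × (∀ v → v ∈ ⟦ V ⟧ ⇔ dot h v ≡ 0F)
normalised-equation V with h , h≢𝟎 , V⇔h ← hyperplane-equation V
                      with g , g∈ , h∼g ← find (normalise h h≢𝟎) =
  g , g∈ , λ v → mk⇔
    (λ v∈V → proportional v (∼-sym h≢𝟎 h∼g) (to (V⇔h v) v∈V))
    (λ gv≡0 → from (V⇔h v) (proportional v h∼g gv≡0))
  where
  open Equivalence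

  proportional : ∀ v {f f′} → f ∼ f′ → dot f′ v ≡ 0F → dot f v ≡ 0F
  proportional v {f} {f′} f∼f′ f′v≡0 =
    -- By symmetry of `dot`, the vector `v` acts as a linear form on the forms `f` and `f′`.
    trans (dot-comm f v) (∼-dot v f∼f′ (trans (dot-comm v f′) f′v≡0))

-- The vectors of 𝒦 and the finite verifications.

conic affine : Vec F 3 → List (Vec F 6)
conic  ℓ = List.map veronese (filter (orthogonal? ℓ) (normalised 3))
affine ℓ = List.map veronese (filter (¬? ∘ orthogonal? ℓ) (normalised 3))

-- As the four vectors of a conic add up to zero, the sum of the first and another one
-- spans the intersection of the line joining these two with the line joining the rest.
triangle : List (Vec F 6) → List (Vec F 6)
triangle []       = []
triangle (v ∷ vs) = List.map (v ⊕_) vs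

𝒦-vectors : Vec F 3 → List (Vec F 6)
𝒦-vectors ℓ = affine ℓ ++ triangle (conic ℓ)

Quadrangle : (a b c d : Vec F n) → Set
Quadrangle a b c d = AllPairs _≁_ (a ∷ b ∷ c ∷ d ∷ [])

quadrangle? : (a b c d : Vec F n) → Dec (Quadrangle a b c d)
quadrangle? a b c d = allPairs? (λ v w → ¬? (v ∼? w)) (a ∷ b ∷ c ∷ d ∷ [])

IsDiagonal : (δ a b c d : Vec F n) → Set
IsDiagonal δ a b c d = Quadrangle a b c d × δ ∈ Span (a ∷ b ∷ []) × δ ∈ Span (c ∷ d ∷ [])

isDiagonal? : (δ a b c d : Vec F n) → Dec (IsDiagonal δ a b c d)
isDiagonal? δ a b c d =
  quadrangle? a b c d ×-dec δ ∈Span? (a ∷ b ∷ []) ×-dec δ ∈Span? (c ∷ d ∷ [])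

-- The lines ab and cd share no point other than that of `δ`. Ranging over coefficients means 9 · 9
-- cases, instead of the 729 vectors of F⁶.
MeetIn : (δ a b c d : Vec F n) → Set
MeetIn δ a b c d = ∀ xs ys →
  combination xs (a ∷ b ∷ []) ≡ combination ys (c ∷ d ∷ []) → combination xs (a ∷ b ∷ []) ∼ δ

meetIn? : (δ a b c d : Vec F n) → Dec (MeetIn δ a b c d)
meetIn? δ a b c d = all-vectors? λ xs → all-vectors? λ ys →
  (combination xs (a ∷ b ∷ []) ≟ⱽ combination ys (c ∷ d ∷ []))
    →-dec (combination xs (a ∷ b ∷ []) ∼? δ)

-- Opaque, since the exhaustive searches must not be run again when these are used.
opaque
  -- As `veronese` is quadratic, scaling by c scales the image by `c * c`.
  veronese-∼⁺ : ∀ v w → v ∼ w → veronese v ∼ veronese w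
  veronese-∼⁺ = toWitness {a? = all-vectors? λ v → all-vectors? λ w →
    (v ∼? w) →-dec (veronese v ∼? veronese w)} _

  -- This is the injectivity of `φ`, which keeps the images of points off the line outside `Γ∞`.
  veronese-∼⁻ : ∀ v w → veronese v ∼ veronese w → v ∼ w
  veronese-∼⁻ = toWitness {a? = all-vectors? λ v → all-vectors? λ w →
    (veronese v ∼? veronese w) →-dec (v ∼? w)} _

  𝒦-vectors-≢𝟎 : All (λ ℓ → All (_≢ 𝟎) (𝒦-vectors ℓ)) (normalised 3)
  𝒦-vectors-≢𝟎 = toWitness {a? = All.all? (λ ℓ →
    All.all? (λ v → ¬? (v ≟ⱽ 𝟎)) (𝒦-vectors ℓ)) (normalised 3)} _

  𝒦-vectors-distinct : All (λ ℓ → AllPairs _≁_ (𝒦-vectors ℓ)) (normalised 3)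
  𝒦-vectors-distinct = toWitness {a? = All.all? (λ ℓ →
    allPairs? (λ v w → ¬? (v ∼? w)) (𝒦-vectors ℓ)) (normalised 3)} _

  𝒦-vectors-length : All (λ ℓ → length (𝒦-vectors ℓ) ≡ 12) (normalised 3)
  𝒦-vectors-length = toWitness {a? = All.all? (λ ℓ →
    length (𝒦-vectors ℓ) ℕ.≟ 12) (normalised 3)} _

  triangle-sound : All (λ ℓ → let Γ = conic ℓ in All (λ δ →
    Any (λ a → Any (λ b → Any (λ c → Any (λ d →
      IsDiagonal δ a b c d) Γ) Γ) Γ) Γ) (triangle Γ)) (normalised 3)
  triangle-sound = toWitness {a? = All.all? (λ ℓ → let Γ = conic ℓ in All.all? (λ δ →
    any? (λ a → any? (λ b → any? (λ c → any? (λ d →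
      isDiagonal? δ a b c d) Γ) Γ) Γ) Γ) (triangle Γ)) (normalised 3)} _

  -- Of the 256 choices of a, b, c, d on a conic, exactly the 24 orderings of its four vectors
  -- satisfy `Quadrangle`.
  triangle-complete : All (λ ℓ → let Γ = conic ℓ in
    All (λ a → All (λ b → All (λ c → All (λ d → Quadrangle a b c d →
      Any (λ δ → MeetIn δ a b c d) (triangle Γ)) Γ) Γ) Γ) Γ) (normalised 3)
  triangle-complete = toWitness {a? = All.all? (λ ℓ → let Γ = conic ℓ in
    All.all? (λ a → All.all? (λ b → All.all? (λ c → All.all? (λ d → quadrangle? a b c d →-dec
      any? (λ δ → meetIn? δ a b c d) (triangle Γ)) Γ) Γ) Γ) Γ) (normalised 3)} _

  section-length : All (λ ℓ → All (λ h →
    let m = length (section h (𝒦-vectors ℓ)) in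
    m ≡ 0 ⊎ m ≡ 3 ⊎ m ≡ 6) (normalised 6)) (normalised 3)
  section-length = toWitness {a? = All.all? (λ ℓ → All.all? (λ h →
    let m = length (section h (𝒦-vectors ℓ)) in
    (m ℕ.≟ 0) ⊎-dec (m ℕ.≟ 3) ⊎-dec (m ℕ.≟ 6)) (normalised 6)) (normalised 3)} _

-- From vectors back to the points of `Γ∞`, `Δ∞` and `𝒦`.

∈-join : (A B Q : Point d) → vec Q ∈ Span (vec A ∷ vec B ∷ []) → Q ∈ join A B
∈-join (subspace (_ ∷ []) _) (subspace (_ ∷ []) _) Q = ⊆-span Q

join-∈ : ∀ {a b} (A B Q : Point d) → vec A ∼ a → vec B ∼ b →
  Q ∈ join A B → vec Q ∈ Span (a ∷ b ∷ [])
join-∈ (subspace (_ ∷ []) _) (subspace (_ ∷ []) _) Q A∼a B∼b Q∈AB =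
  span-minimal (∼⇒∈ A∼a span-here ∷ ∼⇒∈ B∼b (span-there span-here) ∷ []) (∈-span Q Q∈AB)

≈-refl : {P : Point d} → P ≈ P
≈-refl {d} {P} = Setoid.refl (subspaceSetoid 1 (suc d)) {P}

vec-φ : (P : Point 2) → vec (φ P) ≡ veronese (vec P)
vec-φ (subspace (_ ∷ []) _) = refl

∼-φ : ∀ {Q} P → Q ≈ φ P → vec Q ∼ veronese (vec P)
∼-φ {Q} P Q≈φP = subst (vec Q ∼_) (vec-φ P) (≈⇒∼ Q (φ P) Q≈φP)

-- Both directions of proportionality are recorded: one carries the equation of the line from `P` to
-- `v`, the other from `v` to `P`.
φ-representative : (P : Point 2) → ∀ {Q} → Q ≈ φ P →
  ∃ λ v → v ∈ₗ normalised 3 × v ∼ vec P × vec P ∼ v × vec Q ∼ veronese v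
φ-representative P {Q} Q≈φP with v , v∈ , P∼v ← find (normalise (vec P) (vec≢𝟎 P)) =
  v , v∈ , ∼-sym (vec≢𝟎 P) P∼v , P∼v , ∼⇒∈ (∼-φ {Q} P Q≈φP) (veronese-∼⁺ _ _ P∼v)

module _ (l∞ : Line 2) {ℓ : Vec F 3} (ℓ∈ : ℓ ∈ₗ normalised 3)
         (l⇔ℓ : ∀ v → v ∈ ⟦ l∞ ⟧ ⇔ dot ℓ v ≡ 0F) where

  open Equivalence

  private
    on-line : (P : Point 2) → P ∈ points l∞ → dot ℓ (vec P) ≡ 0F
    on-line P P⊆l = to (l⇔ℓ _) (∈-span P P⊆l)

  conic-sound : ∀ {v} → v ∈ₗ conic ℓ → ∃ λ A → A ∈ Γ∞ l∞ × vec A ≡ v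
  conic-sound v∈ with u , u∈ , refl ← ∈-map⁻ veronese v∈
                 with u∈₃ , ℓu≡0 ← ∈-filter⁻ (orthogonal? ℓ) u∈ =
    φ P , (P , ⊆-span P (from (l⇔ℓ _) ℓu≡0) , ≈-refl {P = φ P}) , refl
    where P = point u (normalised-≢𝟎 u∈₃)

  conic-complete : ∀ {A} → A ∈ Γ∞ l∞ → ∃ λ v → v ∈ₗ conic ℓ × vec A ∼ v
  conic-complete {A} (P , P⊆l , A≈φP)
    with v , v∈ , v∼P , _ , A∼φv ← φ-representative P {A} A≈φP =
    veronese v ,
    ∈-map⁺ veronese (∈-filter⁺ (orthogonal? ℓ) v∈ (∼-dot ℓ v∼P (on-line P P⊆l))) ,
    A∼φv

  affine-sound : ∀ {v} → v ∈ₗ affine ℓ → ∃ λ A → A ∈ image U ∖ Γ∞ l∞ × vec A ≡ v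
  affine-sound v∈ with u , u∈ , refl ← ∈-map⁻ veronese v∈
                  with u∈₃ , ℓu≢0 ← ∈-filter⁻ (¬? ∘ orthogonal? ℓ) u∈ =
    -- If this image were also that of a point `P′` on the line, injectivity would make `u`
    -- proportional to `vec P′` and thus a zero of `ℓ`.
    φ P , ((P , _ , ≈-refl {P = φ P}) , λ (P′ , P′⊆l , φP≈φP′) →
      ℓu≢0 (∼-dot ℓ (veronese-∼⁻ u _ (∼-φ {φ P} P′ φP≈φP′)) (on-line P′ P′⊆l))) , refl
    where P = point u (normalised-≢𝟎 u∈₃)

  affine-complete : ∀ {A} → A ∈ image U ∖ Γ∞ l∞ → Any (vec A ∼_) (affine ℓ)
  affine-complete {A} ((P , _ , A≈φP) , A∉Γ)
    with v , v∈ , _ , P∼v , A∼φv ← φ-representative P {A} A≈φP =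
    lose (∈-map⁺ veronese (∈-filter⁺ (¬? ∘ orthogonal? ℓ) v∈ λ ℓv≡0 →
      A∉Γ (P , ⊆-span P (from (l⇔ℓ _) (∼-dot ℓ P∼v ℓv≡0)) , A≈φP))) A∼φv

  triangle⇒Δ∞ : ∀ {v} → v ∈ₗ triangle (conic ℓ) → ∃ λ Q → Q ∈ Δ∞ l∞ × vec Q ≡ v
  triangle⇒Δ∞ {v} v∈
    with a , a∈ , p ← find (lookupᴬ (lookupᴬ triangle-sound ℓ∈) v∈)
    with b , b∈ , p ← find p
    with c , c∈ , p ← find p
    with d , d∈ , quadrangle , v∈ab , v∈cd ← find p
    with (a≁b ∷ a≁c ∷ a≁d ∷ []) ∷ (b≁c ∷ b≁d ∷ []) ∷ (c≁d ∷ []) ∷ [] ∷ [] ← quadrangle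
    with A , A∈ , refl ← conic-sound a∈
       | B , B∈ , refl ← conic-sound b∈
       | C , C∈ , refl ← conic-sound c∈
       | D , D∈ , refl ← conic-sound d∈ =
    Q , (A , B , C , D , (A∈ , B∈ , C∈ , D∈) ,
      (a≁b ∘ ≈⇒∼ A B , a≁c ∘ ≈⇒∼ A C , a≁d ∘ ≈⇒∼ A D ,
       b≁c ∘ ≈⇒∼ B C , b≁d ∘ ≈⇒∼ B D , c≁d ∘ ≈⇒∼ C D) ,
      ∈-join A B Q v∈ab , ∈-join C D Q v∈cd) , refl
    where Q = point v (lookupᴬ (lookupᴬ 𝒦-vectors-≢𝟎 ℓ∈) (∈-++⁺ʳ (affine ℓ) v∈))

  -- Replacing A, B, C, D by proportional conic vectors preserves their joins and their
  -- distinctness. The two expressions of `vec Q`, on AB and on CD, are then what `MeetIn` compares.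
  Δ∞⇒triangle : ∀ {Q} → Q ∈ Δ∞ l∞ → Any (vec Q ∼_) (triangle (conic ℓ))
  Δ∞⇒triangle {Q} (A , B , C , D , (A∈ , B∈ , C∈ , D∈) ,
                   (A≉B , A≉C , A≉D , B≉C , B≉D , C≉D) , Q∈AB , Q∈CD)
    with a , a∈ , A∼a ← conic-complete {A} A∈
       | b , b∈ , B∼b ← conic-complete {B} B∈
       | c , c∈ , C∼c ← conic-complete {C} C∈
       | d , d∈ , D∼d ← conic-complete {D} D∈
    with xs , x≡ ← join-∈ A B Q A∼a B∼b Q∈AB
       | ys , y≡ ← join-∈ C D Q C∼c D∼d Q∈CD =
    Any.map (λ {δ} f → subst (_∼ δ) x≡ (f xs ys (trans x≡ (sym y≡))))
      (lookupᴬ (lookupᴬ (lookupᴬ (lookupᴬ (lookupᴬ triangle-complete ℓ∈) a∈) b∈) c∈) d∈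
        ((sep A B A≉B A∼a B∼b ∷ sep A C A≉C A∼a C∼c ∷ sep A D A≉D A∼a D∼d ∷ []) ∷
         (sep B C B≉C B∼b C∼c ∷ sep B D B≉D B∼b D∼d ∷ []) ∷
         (sep C D C≉D C∼c D∼d ∷ []) ∷ [] ∷ []))
    where
    sep : ∀ P P′ {p p′} → P ≉ P′ → vec P ∼ p → vec P′ ∼ p′ → p ≁ p′
    sep P P′ P≉P′ P∼p P′∼p′ p∼p′ =
      P≉P′ (∼⇒≈ P P′ (∼⇒∈ P∼p (∼⇒∈ p∼p′ (∼-sym (vec≢𝟎 P′) P′∼p′))))

  enumerates-𝒦 : Enumerates (𝒦 l∞) (𝒦-vectors ℓ)
  enumerates-𝒦 = record
    { sound    = sound
    ; complete = λ
      { {Q} (inj₁ Q∈) → ++⁺ˡ (affine-complete {Q} Q∈)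
      ; {Q} (inj₂ Q∈) → ++⁺ʳ (affine ℓ) (Δ∞⇒triangle {Q} Q∈)
      }
    -- This also separates the diagonal points from the nine remaining Veronese points, so the two
    -- parts of `𝒦` do not overlap.
    ; distinct = lookupᴬ 𝒦-vectors-distinct ℓ∈
    }
    where
    sound : ∀ {v} → v ∈ₗ 𝒦-vectors ℓ → ∃ λ P → P ∈ 𝒦 l∞ × vec P ≡ v
    sound v∈ with ∈-++⁻ (affine ℓ) v∈
    ... | inj₁ v∈₁ with P , P∈ , eq ← affine-sound v∈₁ = P , inj₁ P∈ , eq
    ... | inj₂ v∈₂ with P , P∈ , eq ← triangle⇒Δ∞ v∈₂  = P , inj₂ P∈ , eq

theorem1 : (l∞ : Line 2) →
    ((H : Hyperplane 5) →
    HasCardinality (points H ∩ 𝒦 l∞) 0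
    ⊎ HasCardinality (points H ∩ 𝒦 l∞) 3
    ⊎ HasCardinality (points H ∩ 𝒦 l∞) 6)
    × HasCardinality (𝒦 l∞) 12
theorem1 l∞ with ℓ , ℓ∈ , l⇔ℓ ← normalised-equation l∞ =
  sections , subst (HasCardinality (𝒦 l∞)) (lookupᴬ 𝒦-vectors-length ℓ∈) (cardinality E)
  where
  E : Enumerates (𝒦 l∞) (𝒦-vectors ℓ)
  E = enumerates-𝒦 l∞ ℓ∈ l⇔ℓ

  sections : (H : Hyperplane 5) → HasCardinality (points H ∩ 𝒦 l∞) 0
    ⊎ HasCardinality (points H ∩ 𝒦 l∞) 3
    ⊎ HasCardinality (points H ∩ 𝒦 l∞) 6
  sections H with h , h∈ , H⇔h ← normalised-equation H =
    Sum.map resize (Sum.map resize resize) (lookupᴬ (lookupᴬ section-length ℓ∈) h∈)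
    where
    resize : ∀ {m} → length (section h (𝒦-vectors ℓ)) ≡ m → HasCardinality (points H ∩ 𝒦 l∞) m
    resize refl = cardinality (enumerates-section h H H⇔h E)
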